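{- Let $m\ge 1$ be an integer, let $x_1,\dots,x_m$ be elements of a commutative ring, and let $A_m(x_1,\dots,x_m)$ be the $m\times m$ matrix whose $(p,q)$ entry is $x_{m+1-\min(p,q)}$ for $1\le p,q\le m$. Then $$\det(A_m(x_1,\dots,x_m))=\prod_{i=1}^{m}(x_i-x_{i+1}),\qquad\text{where } x_{m+1}=0.$$
   Context: The matrix is, explicitly, $$A_m(x_1,\dots,x_m)=\begin{pmatrix} x_m & x_m & \cdots & x_m & x_m\\ x_m & x_{m-1} & \cdots & x_{m-1} & x_{m-1}\\ \vdots&\vdots&\ddots&\vdots&\vdots\\ x_m & x_{m-1} & \cdots & x_2 & x_2\\ x_m & x_{m-1}&\cdots & x_2 & x_1\end{pmatrix}.$$ -}

module Defs where

open import Algebra.Bundles using (CommutativeRing; Semiring)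
open import Data.Fin.Base using (Fin; zero; suc; toℕ; fromℕ; opposite)
open import Data.Fin.Properties using (≤-totalOrder)
open import Data.Nat.Base using (ℕ; zero; suc)
open import Data.Vec.Functional using (Vector; insertAt; removeAt)
import Algebra.Construct.NaturalChoice.Min as Min
import Algebra.Definitions.RawSemiring as RawSemiringOps

module _ {n : ℕ} where
  open Min (≤-totalOrder n) public using (_⊓_)

module RingDefs {c ℓ} (R : CommutativeRing c ℓ) where
  open CommutativeRing R hiding (zero)
  open RawSemiringOps (Semiring.rawSemiring semiring) public
    using (sum; product; _^_)

  Matrix : ℕ → Set c
  Matrix n = Fin n → Fin n → Carrier

  minor : ∀ {n} → Matrix (suc n) → Fin (suc n) → Matrix n
  minor M j p = removeAt (M (suc p)) j

  -- Cofactor expansion along the first row; the determinant of the empty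
  -- matrix is 1.
  det : ∀ {n} → Matrix n → Carrier
  det {zero}  M = 1#
  det {suc n} M = sum λ j → ((- 1#) ^ toℕ j) * (M zero j * det (minor M j))

  -- Indices are 0-based: the mathematical x₁, …, xₘ are x 0, …, x (m − 1).
  -- Row p and column q are thus numbered p + 1 and q + 1, so the subscript
  -- m + 1 − min (p + 1 , q + 1) is the 0-based index m − 1 − min (p , q),
  -- which is what opposite computes.
  A : ∀ m → Vector Carrier m → Matrix m
  A m x p q = x (opposite (p ⊓ q))

  -- x₁, …, xₘ, xₘ₊₁ with xₘ₊₁ = 0.
  extend : ∀ m → Vector Carrier m → Vector Carrier (suc m)
  extend m x = insertAt x (fromℕ m) 0#

-- Writing y for the reversed sequence xₘ, …, x₁, so that A has entries
-- y (min (p , q)), generalise the first column to an arbitrary constant c.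
-- In the expansion of this bordered matrix along the first row, every minor
-- but the first two has two constant columns and so vanishes. The first minor
-- is bordered by y₁, the second by c, both over the shifted sequence. With
-- P the product of its consecutive differences, the determinant is
--   c (y₁ P) − y₀ (c P) = c (y₁ − y₀) P.

module Submission where

open import Defs
open import Algebra.Bundles using (CommutativeRing)
open import Data.Fin.Base using (Fin; zero; suc; toℕ; fromℕ; inject₁; opposite; punchIn)
open import Data.Fin.Permutation using (reverse)
open import Data.Fin.Properties using (≤-total; ≤-totalOrder)
open import Data.Nat.Base using (ℕ; zero; suc; _≤_; z≤n; s≤s)
open import Data.Sum.Base using ([_,_]′)
open import Data.Vec.Functional using (Vector; tail)
open import Data.Vec.Functional.Properties using (insertAt-lookup)
open import Function.Base using (_∘_)
open import Relation.Binary.PropositionalEquality as ≡ using (_≡_)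
import Algebra.Construct.NaturalChoice.Min as Min
import Algebra.Properties.CommutativeMonoid.Sum as CommutativeMonoidSum
import Algebra.Properties.Ring as RingProperties
import Algebra.Properties.Semiring.Sum as SemiringSum
import Algebra.Solver.Ring.NaturalCoefficients.Default as SemiringSolver
import Relation.Binary.Reasoning.Setoid as SetoidReasoning

⊓-zeroˡ : ∀ {n} (q : Fin (suc n)) → zero ⊓ q ≡ zero
⊓-zeroˡ {n} = Min.⊓-zeroˡ (≤-totalOrder (suc n)) (λ _ → z≤n)

⊓-zeroʳ : ∀ {n} (p : Fin (suc n)) → p ⊓ zero ≡ zero
⊓-zeroʳ {n} = Min.⊓-zeroʳ (≤-totalOrder (suc n)) (λ _ → z≤n)

-- Whichever index is smaller stays smaller after both are shifted. This turns the deletion of a row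
-- and a column into a shift of the sequence.
suc-distrib-⊓ : ∀ {n} (p q : Fin n) → suc p ⊓ suc q ≡ suc (p ⊓ q)
suc-distrib-⊓ {n} p q =
  [ (λ p≤q → ≡.trans (Min.x≤y⇒x⊓y≈x (≤-totalOrder (suc n)) (s≤s p≤q))
      (≡.cong suc (≡.sym (Min.x≤y⇒x⊓y≈x (≤-totalOrder n) p≤q))))
  , (λ q≤p → ≡.trans (Min.x≤y⇒y⊓x≈x (≤-totalOrder (suc n)) (s≤s q≤p))
      (≡.cong suc (≡.sym (Min.x≤y⇒y⊓x≈x (≤-totalOrder n) q≤p))))
  ]′ (≤-total p q)

opposite-inject₁ : ∀ {n} (i : Fin n) → opposite (inject₁ i) ≡ suc (opposite i)
opposite-inject₁ zero    = ≡.refl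
opposite-inject₁ (suc i) = ≡.cong inject₁ (opposite-inject₁ i)

module _ {c ℓ} (R : CommutativeRing c ℓ) where
  open CommutativeRing R hiding (zero)
  open RingDefs R
  open RingProperties ring using (-1*x≈-x; -0#≈0#)
  open SemiringSum semiring using (sum-cong-≋; sum-replicate-zero; *-distribˡ-sum)
  open CommutativeMonoidSum *-commutativeMonoid
    using () renaming (sum-cong-≋ to product-cong; sum-permute to product-permute)
  open SemiringSolver commutativeSemiring using (solve; _:=_; _:+_; _:*_)
  open SetoidReasoning setoid

  cofactorTerm : ∀ {n} → Matrix (suc n) → Vector Carrier (suc n)
  cofactorTerm M j = ((- 1#) ^ toℕ j) * (M zero j * det (minor M j))

  sum-zero : ∀ {n} {t : Vector Carrier n} → (∀ i → t i ≈ 0#) → sum t ≈ 0#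
  sum-zero {n} t≈0 = trans (sum-cong-≋ t≈0) (sum-replicate-zero n)

  det-cong : ∀ {n} (M N : Matrix n) → (∀ p q → M p q ≈ N p q) → det M ≈ det N
  det-cong {zero}  M N M≈N = refl
  det-cong {suc n} M N M≈N = sum-cong-≋ {x = cofactorTerm M} {y = cofactorTerm N} λ j →
    *-congˡ (*-cong (M≈N zero j)
      (det-cong (minor M j) (minor N j) λ p q → M≈N (suc p) (punchIn j q)))

  x*[y*[z*w]]≈y*[z*[x*w]] : ∀ x y z w → x * (y * (z * w)) ≈ y * (z * (x * w))
  x*[y*[z*w]]≈y*[z*[x*w]] =
    solve 4 (λ x y z w → x :* (y :* (z :* w)) := y :* (z :* (x :* w))) refl

  -- By linearity in the first column, the determinants are `a` and `b` times that of the matrix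
  -- with first column all 1; cross-multiplying avoids this third matrix. In the expansion, deleting
  -- column 0 gives equal minors, and deleting any other column gives a smaller instance.
  det-constantColumn :
    ∀ {n} {a b : Carrier} (M N : Matrix (suc n)) →
    (∀ p → M p zero ≈ a) → (∀ p → N p zero ≈ b) →
    (∀ p q → M p (suc q) ≈ N p (suc q)) →
    b * det M ≈ a * det N
  det-constantColumn {n} {a} {b} M N M₀ N₀ M≈N = begin
    b * det M                        ≈⟨ *-distribˡ-sum b (cofactorTerm M) ⟩
    sum ((b *_) ∘ cofactorTerm M)    ≈⟨ sum-cong-≋ (terms n M N M₀ N₀ M≈N) ⟩
    sum ((a *_) ∘ cofactorTerm N)    ≈⟨ *-distribˡ-sum a (cofactorTerm N) ⟨
    a * det N                        ∎
    where
    -- The size is bound anew so that it can be matched: a column `suc j` exists only when `n` is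
    -- positive.
    terms :
      ∀ n (M N : Matrix (suc n)) →
      (∀ p → M p zero ≈ a) → (∀ p → N p zero ≈ b) →
      (∀ p q → M p (suc q) ≈ N p (suc q)) →
      ∀ j → b * cofactorTerm M j ≈ a * cofactorTerm N j
    terms n M N M₀ N₀ M≈N zero = begin
      b * (1# * (M zero zero * det (minor M zero)))
        ≈⟨ *-congˡ (*-congˡ (*-cong (M₀ zero) (det-cong (minor M zero) (minor N zero) λ p → M≈N (suc p)))) ⟩
      b * (1# * (a * det (minor N zero)))
        ≈⟨ solve 4 (λ a b i d → b :* (i :* (a :* d)) := a :* (i :* (b :* d))) refl a b 1# _ ⟩
      a * (1# * (b * det (minor N zero)))
        ≈⟨ *-congˡ (*-congˡ (*-congʳ (N₀ zero))) ⟨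
      a * (1# * (N zero zero * det (minor N zero))) ∎
    terms (suc n) M N M₀ N₀ M≈N (suc j) = begin
      b * (s * (M zero (suc j) * det (minor M (suc j))))
        ≈⟨ x*[y*[z*w]]≈y*[z*[x*w]] b s _ _ ⟩
      s * (M zero (suc j) * (b * det (minor M (suc j))))
        ≈⟨ *-congˡ (*-cong (M≈N zero j)
             (det-constantColumn (minor M (suc j)) (minor N (suc j)) (M₀ ∘ suc) (N₀ ∘ suc)
               λ p q → M≈N (suc p) (punchIn j q))) ⟩
      s * (N zero (suc j) * (a * det (minor N (suc j))))
        ≈⟨ x*[y*[z*w]]≈y*[z*[x*w]] a s _ _ ⟨
      a * (s * (N zero (suc j) * det (minor N (suc j)))) ∎
      where s = (- 1#) ^ toℕ (suc j)

  det-firstTwo :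
    ∀ {n} (M : Matrix (suc (suc n))) →
    (∀ j → det (minor M (suc (suc j))) ≈ 0#) →
    det M ≈ M zero zero * det (minor M zero)
          - M zero (suc zero) * det (minor M (suc zero))
  det-firstTwo M rest≈0 = begin
    -- The factors `1#` and `- 1# * 1#` are the signs of columns 0 and 1, with the powers of `- 1#`
    -- unfolded.
    1# * u + ((- 1# * 1#) * v + sum (tail (tail (cofactorTerm M))))
      ≈⟨ +-cong (*-identityˡ u) (+-congˡ (sum-zero λ j →
           trans (*-congˡ (trans (*-congˡ (rest≈0 j)) (zeroʳ _))) (zeroʳ _))) ⟩
    u + ((- 1# * 1#) * v + 0#)  ≈⟨ +-congˡ (+-identityʳ _) ⟩
    u + (- 1# * 1#) * v         ≈⟨ +-congˡ (*-congʳ (*-identityʳ _)) ⟩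
    u + - 1# * v                ≈⟨ +-congˡ (-1*x≈-x v) ⟩
    u - v                       ∎
    where
    u = M zero zero * det (minor M zero)
    v = M zero (suc zero) * det (minor M (suc zero))

  -- Deleting a later column keeps both constant columns, so those minors vanish by induction. The
  -- first two minors differ only in their first columns, constantly `b` and `a`, so
  -- `det-constantColumn` makes the two remaining terms cancel.
  det-twoConstantColumns :
    ∀ {n} {a b : Carrier} (M : Matrix (suc (suc n))) →
    (∀ p → M p zero ≈ a) → (∀ p → M p (suc zero) ≈ b) → det M ≈ 0#
  det-twoConstantColumns {n} {a} {b} M M₀ M₁ = begin
    det M
      ≈⟨ det-firstTwo M (rest≈0 n M M₀ M₁) ⟩
    M zero zero * det (minor M zero) - M zero (suc zero) * det (minor M (suc zero))
      ≈⟨ +-cong (*-congʳ (M₀ zero)) (-‿cong (*-congʳ (M₁ zero))) ⟩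
    a * det (minor M zero) - b * det (minor M (suc zero))
      ≈⟨ +-congʳ (det-constantColumn (minor M zero) (minor M (suc zero)) (M₁ ∘ suc) (M₀ ∘ suc) λ _ _ → refl) ⟩
    b * det (minor M (suc zero)) - b * det (minor M (suc zero))
      ≈⟨ -‿inverseʳ _ ⟩
    0# ∎
    where
    rest≈0 :
      ∀ n (M : Matrix (suc (suc n))) →
      (∀ p → M p zero ≈ a) → (∀ p → M p (suc zero) ≈ b) →
      ∀ j → det (minor M (suc (suc j))) ≈ 0#
    rest≈0 (suc n) M M₀ M₁ j =
      det-twoConstantColumns (minor M (suc (suc j))) (M₀ ∘ suc) (M₁ ∘ suc)

  differenceProduct : ∀ {n} → Vector Carrier (suc n) → Carrier
  differenceProduct y = product λ i → y (suc i) - y (inject₁ i)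

  -- The constant has to be free for the induction to close: deleting column 1 leaves `a` in front
  -- of columns that now follow `tail y`.
  det-bordered :
    ∀ {n} {a : Carrier} (M : Matrix (suc n)) (y : Vector Carrier (suc n)) →
    (∀ p → M p zero ≈ a) → (∀ p q → M p (suc q) ≈ y (p ⊓ suc q)) →
    det M ≈ a * differenceProduct y
  det-bordered {zero} {a} M y M₀ M₊ = begin
    1# * (M zero zero * 1#) + 0#  ≈⟨ +-identityʳ _ ⟩
    1# * (M zero zero * 1#)       ≈⟨ *-identityˡ _ ⟩
    M zero zero * 1#              ≈⟨ *-congʳ (M₀ zero) ⟩
    a * 1#                        ∎
  det-bordered {suc n} {a} M y M₀ M₊ = begin
    det M
      ≈⟨ det-firstTwo M (rest≈0 n M M₀ column₁) ⟩
    M zero zero * det (minor M zero) - M zero (suc zero) * det (minor M (suc zero))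
      ≈⟨ +-cong
           (*-cong (M₀ zero) (det-bordered (minor M zero) (tail y) column₁ shifted))
           (-‿cong (*-cong
             (trans (M₊ zero zero) (reflexive (≡.cong y (⊓-zeroˡ (suc zero)))))
             (det-bordered (minor M (suc zero)) (tail y) (M₀ ∘ suc) shifted))) ⟩
    a * (y (suc zero) * P) - y zero * (a * P)
      -- The semiring solver knows no negation, so `- 1#` is passed to it as an atom `m`.
      ≈⟨ +-congˡ (-1*x≈-x _) ⟨
    a * (y (suc zero) * P) + - 1# * (y zero * (a * P))
      ≈⟨ solve 5 (λ a y₁ y₀ P m →
           a :* (y₁ :* P) :+ m :* (y₀ :* (a :* P)) := a :* ((y₁ :+ m :* y₀) :* P))
           refl a (y (suc zero)) (y zero) P (- 1#) ⟩
    a * ((y (suc zero) + - 1# * y zero) * P)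
      ≈⟨ *-congˡ (*-congʳ (+-congˡ (-1*x≈-x _))) ⟩
    a * ((y (suc zero) - y zero) * P) ∎
    where
    P = differenceProduct (tail y)

    -- Both surviving minors share the columns from index 2 on, so this serves the two recursive
    -- calls alike.
    shifted : ∀ p q → M (suc p) (suc (suc q)) ≈ tail y (p ⊓ suc q)
    shifted p q = trans (M₊ (suc p) (suc q))
      (reflexive (≡.cong y (suc-distrib-⊓ p (suc q))))

    column₁ : ∀ p → M (suc p) (suc zero) ≈ y (suc zero)
    column₁ p = trans (M₊ (suc p) zero)
      (reflexive (≡.cong y (≡.trans (suc-distrib-⊓ p zero) (≡.cong suc (⊓-zeroʳ p)))))

    -- Column 1 has `y zero` in its top row and `y (suc zero)` below, so constancy is asked only of
    -- the rows that a minor keeps.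
    rest≈0 :
      ∀ n {b} (M : Matrix (suc (suc n))) →
      (∀ p → M p zero ≈ a) → (∀ p → M (suc p) (suc zero) ≈ b) →
      ∀ j → det (minor M (suc (suc j))) ≈ 0#
    rest≈0 (suc n) M M₀ M₁ j =
      det-twoConstantColumns (minor M (suc (suc j))) (M₀ ∘ suc) M₁

  extend-inject₁ : ∀ {m} (x : Vector Carrier m) i → extend m x (inject₁ i) ≡ x i
  extend-inject₁ x zero    = ≡.refl
  extend-inject₁ x (suc i) = extend-inject₁ (tail x) i

  extend-fromℕ : ∀ {m} (x : Vector Carrier m) → extend m x (fromℕ m) ≡ 0#
  extend-fromℕ {m} x = insertAt-lookup x (fromℕ m) 0#

  -- Reversing the order of the factors turns steps of the reversed sequence into differences of
  -- `x`. The leading factor is the last difference, since the appended entry is 0.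
  differenceProduct-reverse :
    ∀ {n} (x : Vector Carrier (suc n)) →
    x (fromℕ n) * differenceProduct (x ∘ opposite) ≈
    product (λ i → extend (suc n) x (inject₁ i) - extend (suc n) x (suc i))
  differenceProduct-reverse {n} x = begin
    x (fromℕ n) * differenceProduct (x ∘ opposite)
      -- The head of the reversed product is `d (fromℕ n)`, as `opposite zero` reduces to `fromℕ n`.
      ≈⟨ *-cong first (product-cong others) ⟩
    product (d ∘ opposite)
      ≈⟨ product-permute d reverse ⟨
    product d ∎
    where
    z = extend (suc n) x

    d : Vector Carrier (suc n)
    d i = z (inject₁ i) - z (suc i)

    first : x (fromℕ n) ≈ d (fromℕ n)
    first = begin
      x (fromℕ n)       ≈⟨ +-identityʳ _ ⟨
      x (fromℕ n) + 0#  ≈⟨ +-congˡ -0#≈0# ⟨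
      x (fromℕ n) - 0#  ≡⟨ ≡.cong₂ _-_ (extend-inject₁ x (fromℕ n)) (extend-fromℕ x) ⟨
      d (fromℕ n)       ∎

    -- `opposite (suc i)` is `inject₁ (opposite i)`, and `suc (inject₁ j)` is `inject₁ (suc j)` by
    -- computation, so both entries of `z` lie before the appended 0.
    others : ∀ i → x (opposite (suc i)) - x (opposite (inject₁ i)) ≈ d (opposite (suc i))
    others i = reflexive (≡.cong₂ _-_
      (≡.sym (extend-inject₁ x (inject₁ (opposite i))))
      (≡.trans (≡.cong x (opposite-inject₁ i)) (≡.sym (extend-inject₁ x (suc (opposite i))))))

proposition1p1 : ∀ {c ℓ} (R : CommutativeRing c ℓ) →
    let open CommutativeRing R
        open RingDefs R
    in
    (m : ℕ) → 1 ≤ m → (x : Vector Carrier m) →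
    det (A m x) ≈ product (λ (i : Fin m) → extend m x (inject₁ i) - extend m x (suc i))
proposition1p1 R (suc n) _ x =
  trans
    -- The border constant is the first value of the reversed sequence, `x (opposite zero)`.
    (det-bordered R (RingDefs.A R (suc n) x) (x ∘ opposite)
      (λ p → reflexive (≡.cong (x ∘ opposite) (⊓-zeroʳ p)))
      (λ p q → refl))
    (differenceProduct-reverse R x)
  where open CommutativeRing R using (trans; refl; reflexive)
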